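{- Let $x$ be a hypergame. Then: - $x\triangleright 0$ iff $x$ has a non-losing strategy for L; - $x\triangleleft 0$ iff $x$ has a non-losing strategy for R; - $x\bowtie 0$ iff $x$ has a non-losing strategy for II; - $x\,\|\,0$ iff $x$ has a non-losing strategy for I.
   Context: Hypergames: work in a universe of possibly non-wellfounded sets (set theory with the Antifoundation Axiom, and the Axiom of Choice). The class $\mathcal H$ of hypergames (also called games) is the carrier of the final coalgebra $(\mathcal H,\mathrm{id})$ of the functor $F(A)=\mathcal P(A)\times\mathcal P(A)$ on the category of classes and functional classes, where $\mathcal P$ is the powerset functor. Thus a hypergame is a pair $x=(X^L,X^R)$ of sets of hypergames; elements $x^L\in X^L$ and $x^R\in X^R$ are the Left and Right options of $x$. Positions of $x$ are the hypergames hereditarily reachable from $x$. $0=(\emptyset,\emptyset)$. Relations: let $\Phi$ be the (componentwise monotone) operator on pairs of binary relations on $\mathcal H$ given by $$\Phi(\mathcal R_1,\mathcal R_2)=\big(\{(x,y)\mid \forall x^R\in X^R.\ y\,\mathcal R_2\,x^R\ \wedge\ \forall y^L\in Y^L.\ y^L\,\mathcal R_2\,x\},\ \{(x,y)\mid \exists x^R\in X^R.\ y\,\mathcal R_1\,x^R\ \vee\ \exists y^L\in Y^L.\ y^L\,\mathcal R_1\,x\}\big).$$ The pair $(\trianglerighteq,\blacktriangleright)$ is the greatest fixpoint of $\Phi$ (note that $\blacktriangleright$ need not be the complement of $\trianglerighteq$). Define: $x\triangleright y$ iff $x\trianglerighteq y$ and $y\blacktriangleright x$; $x\triangleleft y$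 iff $y\triangleright x$; $x\bowtie y$ iff $x\trianglerighteq y$ and $y\trianglerighteq x$; $x\,\|\,y$ iff $x\blacktriangleright y$ and $y\blacktriangleright x$. Plays: L (Left) and R (Right) move alternately; either may start. Player I is the one who starts, player II the other one; LI means L acting as player I, and similarly LII, RI, RII. A play on $x$ is a (possibly empty) finite or infinite sequence $x_1^{K_1}x_2^{K_2}\cdots$ with $K_i\in\{L,R\}$ and $K_{i+1}\neq K_i$, such that, with $x_0=x$ and $x_i=(X_i^L,X_i^R)$, one has $x_{i+1}\in X_i^{K_{i+1}}$ for all $i\ge 0$. A finite play is winning for L (resp. R) if it ends with a position $y=(Y^L,Y^R)$ where R (resp. L) is next to move but $Y^R=\emptyset$ (resp. $Y^L=\emptyset$); the empty play ends at $x$ with the starting player next to move. Every infinite play is a draw. A play is non-losing for L (resp. R) if it is winning for L (resp. R) or is a draw. Strategies: for P in $\{$LI, LII, RI, RII$\}$ let $\mathrm{FPlay}^P_x$ be the set of finite plays on $x$ in which P has the prescribed role (first or second player) and is next to move (the empty play is included exactly when P is LI or RI). A strategy for P on $x$ is a partial function $f$ from $\mathrm{FPlay}^P_x$ to positions of $x$ such that $f(\pi)=x'$ implies that $\pi x'$ is a play, and $f(\pi)$ is defined whenever some $\pi x'$ is a play. The opponent of LI is RII, and of LII is RI (and conversely). A play $\pi$ is coherent with $f$ if for each proper prefix $\pi'$ of $\pi$ where P is next to move, $f(\pi')=x'$ implies $\pi'x'$ is a prefix of $\pi$. For a strategy $f$ for P and a strategy $f'$ for the opponent, $f*f'$ is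 the unique maximal play coherent with both. $f$ is non-losing for P if $f*f'$ is non-losing for P (i.e. for L or R accordingly) for every strategy $f'$ of the opponent. A strategy for L is a pair of strategies for LI and LII; for R, for RI and RII; for I, for LI and RI; for II, for LII and RII. Such a pair is non-losing if both components are. -}

module Defs where

open import Axiom.ExcludedMiddle using (ExcludedMiddle)
open import Data.Empty using (⊥-elim)
open import Data.Maybe using (Maybe; just; Is-just)
open import Data.Maybe.Relation.Binary.Pointwise using (Pointwise; just-inv)
open import Data.Maybe.Relation.Unary.Any using (just)
open import Data.Nat using (ℕ; zero; suc; _≤_)
open import Data.Nat.Properties using (≤-reflexive; ≤-trans; m≤n⇒m≤1+n; <-irrefl)
open import Data.Product using (Σ; ∃-syntax; _×_; _,_; proj₁; proj₂)
open import Data.Sum using (_⊎_; inj₁; inj₂)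
open import Data.Unit using (⊤; tt)
open import Function.Bundles using (Func)
open import Level using (Level; 0ℓ; _⊔_) renaming (suc to lsuc)
open import Relation.Binary using (Rel; REL; Setoid; _⇒_; _Respectsˡ_; _Respectsʳ_)
open import Relation.Binary.PropositionalEquality using (_≡_; refl; sym; trans; cong; subst)
open import Relation.Nullary using (¬_; yes; no)
open import Relation.Nullary.Decidable using (True; toWitness; fromWitness)
open import Relation.Unary using (Pred; _∈_; Empty; ∅)

1ℓ : Level
1ℓ = lsuc 0ℓ

-- The choice function has to respect the equality of the setoids, so this is
-- the axiom of set theory and not the provable distributivity of Π over Σ.
-- With c = 0ℓ it concerns sets only, not proper classes such as Hypergame.
AxiomOfChoice : ∀ c ℓ r → Set (lsuc (c ⊔ ℓ ⊔ r))
AxiomOfChoice c ℓ r =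
  (A B : Setoid c ℓ) (let open Setoid) (R : REL (Carrier A) (Carrier B) r) →
  R Respectsˡ (_≈_ A) → R Respectsʳ (_≈_ B) →
  (∀ a → ∃[ b ] R a b) →
  Σ (Func A B) λ f → ∀ a → R a (Func.to f a)

data Player : Set where
  left right : Player

opponent : Player → Player
opponent left  = right
opponent right = left

-- A hypergame is given by a picture: a small coalgebra of
-- A ↦ 𝒫 A × 𝒫 A together with a chosen node.  By Antifoundation every
-- picture is decorated by exactly one pair of sets of hypergames, every
-- hypergame has a picture (its positions), and two pictures depict the same
-- hypergame iff they are bisimilar.  Hence bisimilarity _≈_ below is the
-- equality of hypergames, and all notions are formulated up to _≈_.
record Hypergame : Set₁ where
  field
    Node   : Set
    option : Player → Node → Pred Node 0ℓ
    root   : Node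

open Hypergame

_at_ : (x : Hypergame) → Node x → Hypergame
x at n = record x { root = n }

infix 4 _≈_
record _≈_ (x y : Hypergame) : Set₁ where
  constructor bisimilar
  field
    bisimulation : REL (Node x) (Node y) 0ℓ
    forth   : ∀ {p m n m′} → bisimulation m n → m′ ∈ option x p m →
              ∃[ n′ ] n′ ∈ option y p n × bisimulation m′ n′
    back    : ∀ {p m n n′} → bisimulation m n → n′ ∈ option y p n →
              ∃[ m′ ] m′ ∈ option x p m × bisimulation m′ n′
    related : bisimulation (root x) (root y)

-- Options left x and Options right x are the sets X^L and X^R.
record Options (p : Player) (x y : Hypergame) : Set₁ where
  constructor option-at
  field
    node    : Node x
    node∈   : node ∈ option x p (root x)
    depicts : x at node ≈ y

𝟘 : Hypergame
𝟘 = record { Node = ⊤ ; option = λ _ _ → ∅ ; root = tt }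

------------------------------------------------------------------------
-- Relations

Φ₁ Φ₂ : ∀ {ℓ} → Rel Hypergame ℓ → Rel Hypergame (1ℓ ⊔ ℓ)
Φ₁ R₂ x y = (∀ xᴿ → xᴿ ∈ Options right x → R₂ y xᴿ)
          × (∀ yᴸ → yᴸ ∈ Options left  y → R₂ yᴸ x)
Φ₂ R₁ x y = (∃[ xᴿ ] xᴿ ∈ Options right x × R₁ y xᴿ)
          ⊎ (∃[ yᴸ ] yᴸ ∈ Options left  y × R₁ yᴸ x)

-- (R₁ , R₂) ⊆ Φ (R₁ , R₂)
IsPostfixpoint : ∀ {ℓ} → Rel Hypergame ℓ → Rel Hypergame ℓ → Set (1ℓ ⊔ ℓ)
IsPostfixpoint R₁ R₂ = (R₁ ⇒ Φ₁ R₂) × (R₂ ⇒ Φ₂ R₁)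

infix 4 _⊵_ _▶_ _▷_ _◁_ _⋈_ _∥_

-- The greatest fixpoint of Φ, as the union of all its post-fixpoints.  Under
-- excluded middle Set-valued relations are as general as Set₁-valued ones, and
-- the pair is the greatest fixpoint: ⊵▶-postfixpoint, ⊵▶-fixpoint, ⊵▶-greatest.
_⊵_ _▶_ : Rel Hypergame 1ℓ
x ⊵ y = ∃[ R₁ ] ∃[ R₂ ] IsPostfixpoint {0ℓ} R₁ R₂ × R₁ x y
x ▶ y = ∃[ R₁ ] ∃[ R₂ ] IsPostfixpoint {0ℓ} R₁ R₂ × R₂ x y

_▷_ _◁_ _⋈_ _∥_ : Rel Hypergame 1ℓ
x ▷ y = x ⊵ y × y ▶ x
x ◁ y = y ▷ x
x ⋈ y = x ⊵ y × y ⊵ x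
x ∥ y = x ▶ y × y ▶ x

------------------------------------------------------------------------
-- Plays

infixl 5 _▹_⟨_⟩

-- Finite plays on x in which s is the player who starts; the labels Kᵢ are
-- determined by s and alternation.
data FPlay (s : Player) (x : Hypergame) : Set₁
next : ∀ {s x} → FPlay s x → Player
last : ∀ {s x} → FPlay s x → Hypergame

data FPlay s x where
  []      : FPlay s x
  _▹_⟨_⟩ : (π : FPlay s x) (y : Hypergame) → y ∈ Options (next π) (last π) → FPlay s x

next {s} []        = s
next (π ▹ _ ⟨ _ ⟩) = opponent (next π)

last {x = x} []    = x
last (_ ▹ y ⟨ _ ⟩) = y

length : ∀ {s x} → FPlay s x → ℕ
length []            = zero
length (π ▹ _ ⟨ _ ⟩) = suc (length π)

mover : Player → ℕ → Player
mover s zero    = s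
mover s (suc i) = opponent (mover s i)

record IPlay (s : Player) (x : Hypergame) : Set₁ where
  field
    position : ℕ → Hypergame
    start    : position 0 ≈ x
    move     : ∀ i → position (suc i) ∈ Options (mover s i) (position i)

open IPlay

data Play (s : Player) (x : Hypergame) : Set₁ where
  fin : FPlay s x → Play s x
  inf : IPlay s x → Play s x

module _ {s : Player} {x : Hypergame} where

  infix 4 _≋_ _⊑_ _⊏_

  -- Equality of finite sequences of hypergames.
  data _≋_ : Rel (FPlay s x) 1ℓ where
    []  : [] ≋ []
    _▹_ : ∀ {π ρ y z y∈ z∈} → π ≋ ρ → y ≈ z → π ▹ y ⟨ y∈ ⟩ ≋ ρ ▹ z ⟨ z∈ ⟩

  -- π ⊑ ρ : π is a prefix of ρ.
  data _⊑_ : Rel (Play s x) 1ℓ where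
    fin-≋    : ∀ {π ρ} → π ≋ ρ → fin π ⊑ fin ρ
    fin-▹    : ∀ {π ρ y y∈} → fin π ⊑ fin ρ → fin π ⊑ fin (ρ ▹ y ⟨ y∈ ⟩)
    inf-[]   : ∀ {α} → fin [] ⊑ inf α
    inf-▹    : ∀ {π α y y∈} → fin π ⊑ inf α → y ≈ position α (suc (length π)) →
               fin (π ▹ y ⟨ y∈ ⟩) ⊑ inf α
    inf-inf  : ∀ {α β} → (∀ i → position α i ≈ position β i) → inf α ⊑ inf β

  _⊏_ : Rel (Play s x) 1ℓ
  π ⊏ ρ = π ⊑ ρ × ¬ (ρ ⊑ π)

  data Winning (p : Player) : Pred (Play s x) 1ℓ where
    win : ∀ {π} → next π ≡ opponent p → Empty (Options (next π) (last π)) →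
          Winning p (fin π)

  data Draw : Pred (Play s x) 1ℓ where
    draw : ∀ {α} → Draw (inf α)

  NonLosing : Player → Pred (Play s x) 1ℓ
  NonLosing p π = Winning p π ⊎ Draw π

------------------------------------------------------------------------
-- Strategies

-- Player p in the plays started by s.
record Role : Set where
  constructor _startedBy_
  field
    player  : Player
    starter : Player

open Role

LI LII RI RII : Role
LI  = left  startedBy left
LII = left  startedBy right
RI  = right startedBy right
RII = right startedBy left

adversary : Role → Role
adversary (p startedBy s) = opponent p startedBy s

record Strategy (P : Role) (x : Hypergame) : Set₁ where
  field
    -- A partial function on the finite plays in which P is next to move.
    respond  : (π : FPlay (starter P) x) → next π ≡ player P → Maybe Hypergame
    respects : ∀ {π ρ} (π-next : next π ≡ player P) (ρ-next : next ρ ≡ player P) →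
               π ≋ ρ → Pointwise _≈_ (respond π π-next) (respond ρ ρ-next)
    -- In particular the values are positions of x.
    legal    : ∀ {π π-next y} → respond π π-next ≡ just y → y ∈ Options (next π) (last π)
    defined  : ∀ {π y} (π-next : next π ≡ player P) →
               y ∈ Options (next π) (last π) → Is-just (respond π π-next)

open Strategy

Coherent : ∀ {P x} → Strategy P x → Pred (Play (starter P) x) 1ℓ
Coherent {P} {x} f π =
  ∀ {ρ ρ-next y} (fρ≡y : respond f ρ ρ-next ≡ just y) →
  fin ρ ⊏ π → fin (ρ ▹ y ⟨ legal f fρ≡y ⟩) ⊑ π

Maximal : ∀ {s x} → Pred (Play s x) 1ℓ → Pred (Play s x) 1ℓ
Maximal C π = π ∈ C × (∀ ρ → ρ ∈ C → π ⊑ ρ → ρ ⊑ π)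

-- π ∈ f ∗ f′ : π is the maximal play coherent with f and f′.  It exists and
-- is unique by ∗-exists and ∗-unique.
infix 6 _∗_
_∗_ : ∀ {P x} → Strategy P x → Strategy (adversary P) x → Pred (Play (starter P) x) 1ℓ
f ∗ f′ = Maximal (λ π → Coherent f π × Coherent f′ π)

IsNonLosing : ∀ {P x} → Pred (Strategy P x) 1ℓ
IsNonLosing {P} f = ∀ f′ π → π ∈ f ∗ f′ → NonLosing (player P) π

-- Pairs of roles; I is the player who starts and II the other one.
data Side : Set where
  L R I II : Side

role₁ role₂ : Side → Role
role₁ L  = LI
role₁ R  = RI
role₁ I  = LI
role₁ II = LII
role₂ L  = LII
role₂ R  = RII
role₂ I  = RI
role₂ II = RII

StrategyFor : Side → Hypergame → Set₁
StrategyFor S x = Strategy (role₁ S) x × Strategy (role₂ S) x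

HasNonLosingStrategy : Side → Hypergame → Set₁
HasNonLosingStrategy S x =
  Σ (StrategyFor S x) λ (f , g) → IsNonLosing f × IsNonLosing g

------------------------------------------------------------------------
-- Equality of hypergames

≈-refl : ∀ {x} → x ≈ x
≈-refl = bisimilar _≡_ (λ { refl m′∈ → _ , m′∈ , refl })
                       (λ { refl n′∈ → _ , n′∈ , refl }) refl

≈-sym : ∀ {x y} → x ≈ y → y ≈ x
≈-sym (bisimilar S forth back Sxy) = bisimilar (λ n m → S m n) back forth Sxy

≈-trans : ∀ {x y z} → x ≈ y → y ≈ z → x ≈ z
≈-trans (bisimilar S S-forth S-back Sxy) (bisimilar T T-forth T-back Tyz) =
  bisimilar (λ l n → ∃[ m ] S l m × T m n)
    (λ (m , Slm , Tmn) l′∈ → let (m′ , m′∈ , Sl′m′) = S-forth Slm l′∈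
                                 (n′ , n′∈ , Tm′n′) = T-forth Tmn m′∈
                             in n′ , n′∈ , m′ , Sl′m′ , Tm′n′)
    (λ (m , Slm , Tmn) n′∈ → let (m′ , m′∈ , Tm′n′) = T-back Tmn n′∈
                                 (l′ , l′∈ , Sl′m′) = S-back Slm m′∈
                             in l′ , l′∈ , m′ , Sl′m′ , Tm′n′)
    (_ , Sxy , Tyz)

Options-resp : ∀ {p q x x′ y y′} → p ≡ q → x ≈ x′ → y ≈ y′ → y ∈ Options p x → y′ ∈ Options q x′
Options-resp refl (bisimilar S forth back Sxx′) y≈y′ (option-at m m∈ xm≈y) =
  let (n , n∈ , Smn) = forth Sxx′ m∈
  in option-at n n∈ (≈-trans (≈-sym (bisimilar S forth back Smn)) (≈-trans xm≈y y≈y′))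

------------------------------------------------------------------------
-- (_⊵_ , _▶_) is the greatest fixpoint of Φ

Φ₁-mono : ∀ {a b} {R : Rel Hypergame a} {S : Rel Hypergame b} → R ⇒ S → Φ₁ R ⇒ Φ₁ S
Φ₁-mono R⊆S (r , l) = (λ z z∈ → R⊆S (r z z∈)) , (λ z z∈ → R⊆S (l z z∈))

Φ₂-mono : ∀ {a b} {R : Rel Hypergame a} {S : Rel Hypergame b} → R ⇒ S → Φ₂ R ⇒ Φ₂ S
Φ₂-mono R⊆S (inj₁ (z , z∈ , r)) = inj₁ (z , z∈ , R⊆S r)
Φ₂-mono R⊆S (inj₂ (z , z∈ , l)) = inj₂ (z , z∈ , R⊆S l)

⊵▶-postfixpoint : IsPostfixpoint _⊵_ _▶_
⊵▶-postfixpoint =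
    (λ { (R₁ , R₂ , R-post@(post₁ , _) , r) → Φ₁-mono {S = _▶_} (λ r′ → R₁ , R₂ , R-post , r′) (post₁ r) })
  , (λ { (R₁ , R₂ , R-post@(_ , post₂) , r) → Φ₂-mono {S = _⊵_} (λ r′ → R₁ , R₂ , R-post , r′) (post₂ r) })

module _ (em : ExcludedMiddle 1ℓ) where

  ⊵▶-greatest : ∀ {R₁ R₂ : Rel Hypergame 1ℓ} → IsPostfixpoint R₁ R₂ →
                (R₁ ⇒ _⊵_) × (R₂ ⇒ _▶_)
  ⊵▶-greatest {R₁} {R₂} (post₁ , post₂) =
      (λ r → ⌊ R₁ ⌋ , ⌊ R₂ ⌋ , ⌊post⌋ , fromWitness r)
    , (λ r → ⌊ R₁ ⌋ , ⌊ R₂ ⌋ , ⌊post⌋ , fromWitness r)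
    where
    ⌊_⌋ : Rel Hypergame 1ℓ → Rel Hypergame 0ℓ
    ⌊ T ⌋ x y = True (em {T x y})
    ⌊post⌋ : IsPostfixpoint ⌊ R₁ ⌋ ⌊ R₂ ⌋
    ⌊post⌋ = (λ r → Φ₁-mono {S = ⌊ R₂ ⌋} fromWitness (post₁ (toWitness r)))
           , (λ r → Φ₂-mono {S = ⌊ R₁ ⌋} fromWitness (post₂ (toWitness r)))

  ⊵▶-fixpoint : (Φ₁ _▶_ ⇒ _⊵_) × (Φ₂ _⊵_ ⇒ _▶_)
  ⊵▶-fixpoint = ⊵▶-greatest (Φ₁-mono {S = Φ₂ _⊵_} (proj₂ ⊵▶-postfixpoint) , Φ₂-mono {S = Φ₁ _▶_} (proj₁ ⊵▶-postfixpoint))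

------------------------------------------------------------------------
-- f ∗ f′ exists and is unique

module _ {s : Player} {x : Hypergame} where

  private variable
    π ρ σ : FPlay s x
    α : IPlay s x

  ≋-refl : π ≋ π
  ≋-refl {[]}            = []
  ≋-refl {π ▹ _ ⟨ _ ⟩} = ≋-refl ▹ ≈-refl

  ≋-sym : π ≋ ρ → ρ ≋ π
  ≋-sym []          = []
  ≋-sym (e ▹ y≈z) = ≋-sym e ▹ ≈-sym y≈z

  ≋-trans : π ≋ ρ → ρ ≋ σ → π ≋ σ
  ≋-trans []        []          = []
  ≋-trans (e ▹ y≈z) (e′ ▹ z≈w) = ≋-trans e e′ ▹ ≈-trans y≈z z≈w

  ≋-next : π ≋ ρ → next π ≡ next ρ
  ≋-next []      = refl
  ≋-next (e ▹ _) = cong opponent (≋-next e)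

  ≋-last : π ≋ ρ → last π ≈ last ρ
  ≋-last []        = ≈-refl
  ≋-last (_ ▹ y≈z) = y≈z

  ≋-length : π ≋ ρ → length π ≡ length ρ
  ≋-length []      = refl
  ≋-length (e ▹ _) = cong suc (≋-length e)

  next≡mover : ∀ (π : FPlay s x) → next π ≡ mover s (length π)
  next≡mover []              = refl
  next≡mover (π ▹ _ ⟨ _ ⟩) = cong opponent (next≡mover π)

  ⊑-length : fin π ⊑ fin ρ → length π ≤ length ρ
  ⊑-length (fin-≋ e) = ≤-reflexive (≋-length e)
  ⊑-length (fin-▹ q) = m≤n⇒m≤1+n (⊑-length q)

  ▹-⋢ : ∀ {y y∈} → π ≋ ρ → ¬ (fin (π ▹ y ⟨ y∈ ⟩) ⊑ fin ρ)
  ▹-⋢ e q = <-irrefl (≋-length e) (⊑-length q)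

  []⊑ : ∀ {τ : Play s x} → fin [] ⊑ τ
  []⊑ {fin []}              = fin-≋ []
  []⊑ {fin (_ ▹ _ ⟨ _ ⟩)} = fin-▹ []⊑
  []⊑ {inf _}               = inf-[]

  ≋-⊑ : ∀ {τ} → π ≋ ρ → fin ρ ⊑ τ → fin π ⊑ τ
  ≋-⊑ e         (fin-≋ e′)     = fin-≋ (≋-trans e e′)
  ≋-⊑ e         (fin-▹ q)      = fin-▹ (≋-⊑ e q)
  ≋-⊑ []        inf-[]         = inf-[]
  ≋-⊑ (e ▹ y≈z) (inf-▹ {α = α} q z≈) =
    inf-▹ (≋-⊑ e q) (≈-trans y≈z (subst (λ n → _ ≈ position α (suc n)) (sym (≋-length e)) z≈))

  ▹-⊑ : ∀ {y y∈ τ} → fin (π ▹ y ⟨ y∈ ⟩) ⊑ τ → fin π ⊑ τ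
  ▹-⊑ (fin-≋ (e ▹ _)) = fin-▹ (fin-≋ e)
  ▹-⊑ (fin-▹ q)       = fin-▹ (▹-⊑ q)
  ▹-⊑ (inf-▹ q _)     = q

  ⊑-trans : ∀ {τ} → fin π ⊑ fin ρ → fin ρ ⊑ τ → fin π ⊑ τ
  ⊑-trans (fin-≋ e) q′ = ≋-⊑ e q′
  ⊑-trans (fin-▹ q) q′ = ⊑-trans q (▹-⊑ q′)

  ⊑-antisym : fin π ⊑ fin ρ → fin ρ ⊑ fin π → π ≋ ρ
  ⊑-antisym (fin-≋ e) _ = e
  ⊑-antisym (fin-▹ q) q′ = ⊥-elim (<-irrefl refl (⊑-length (⊑-trans q′ q)))

  ⊏-▹ : ∀ {y y∈} → fin π ⊏ fin (π ▹ y ⟨ y∈ ⟩)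
  ⊏-▹ = fin-▹ (fin-≋ ≋-refl) , ▹-⋢ ≋-refl

  ⊑-last : ∀ {π} → fin π ⊑ inf α → last π ≈ position α (length π)
  ⊑-last {α = α} {[]} q = ≈-sym (start α)
  ⊑-last (inf-▹ _ y≈) = y≈

  ⊑-stuck : ∀ {τ} → Empty (Options (next π) (last π)) → fin π ⊑ τ → τ ⊑ fin π
  ⊑-stuck stuck (fin-≋ e) = fin-≋ (≋-sym e)
  ⊑-stuck {π} stuck (fin-▹ {ρ = ρ} {y∈ = y∈} q) with ⊑-antisym q (⊑-stuck stuck q)
  ... | e = ⊥-elim (stuck _ (Options-resp (sym (≋-next e)) (≈-sym (≋-last e)) ≈-refl y∈))
  ⊑-stuck {π} {inf α} stuck q =
    ⊥-elim (stuck _ (Options-resp (sym (next≡mover π)) (≈-sym (⊑-last q)) ≈-refl (move α (length π))))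

  take : (α : IPlay s x) (n : ℕ) → Σ (FPlay s x) λ π → length π ≡ n × fin π ⊑ inf α
  take α zero    = [] , refl , inf-[]
  take α (suc n) with take α n
  ... | π , refl , q =
    π ▹ position α (suc n) ⟨ Options-resp (sym (next≡mover π)) (≈-sym (⊑-last q)) ≈-refl (move α n) ⟩
    , refl , inf-▹ q ≈-refl

  ⊑-compare : ∀ {τ} → fin π ⊑ τ → fin ρ ⊑ τ → fin π ⊑ fin ρ ⊎ fin ρ ⊑ fin π
  ⊑-compare (fin-≋ e) q = inj₂ (⊑-trans q (fin-≋ (≋-sym e)))
  ⊑-compare q@(fin-▹ _) (fin-≋ e) = inj₁ (⊑-trans q (fin-≋ (≋-sym e)))
  ⊑-compare (fin-▹ q) (fin-▹ r) = ⊑-compare q r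
  ⊑-compare inf-[] _ = inj₁ []⊑
  ⊑-compare q@(inf-▹ _ _) inf-[] = inj₂ []⊑
  ⊑-compare {τ = inf α} q@(inf-▹ q₀ y≈) r@(inf-▹ r₀ z≈) with ⊑-compare q r₀
  ... | inj₁ u         = inj₁ (fin-▹ u)
  ... | inj₂ (fin-≋ e) = inj₁ (fin-▹ (fin-≋ (≋-sym e)))
  ... | inj₂ (fin-▹ u) with ⊑-compare q₀ r
  ...   | inj₂ v         = inj₂ (fin-▹ v)
  ...   | inj₁ (fin-≋ e) = inj₂ (fin-▹ (fin-≋ (≋-sym e)))
  ...   | inj₁ (fin-▹ v) =
    let e = ⊑-antisym v u
    in inj₁ (fin-≋ (e ▹ ≈-trans y≈ (subst (λ n → position α (suc n) ≈ _) (sym (≋-length e)) (≈-sym z≈))))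

data Turn (P : Role) (p : Player) : Set where
  mine   : p ≡ player P → Turn P p
  theirs : p ≡ player (adversary P) → Turn P p

≢opponent : ∀ {p} → ¬ (p ≡ opponent p)
≢opponent {left}  ()
≢opponent {right} ()

turn : ∀ P p → Turn P p
turn (left  startedBy _) left  = mine refl
turn (left  startedBy _) right = theirs refl
turn (right startedBy _) left  = theirs refl
turn (right startedBy _) right = mine refl

just-of : ∀ {A : Set₁} {m : Maybe A} → Is-just m → ∃[ a ] m ≡ just a
just-of (just _) = _ , refl

module _ {P : Role} {x : Hypergame} where

  Coherent-⊑ : ∀ (g : Strategy P x) {π τ} → fin π ⊑ τ → Coherent g τ → Coherent g (fin π)
  Coherent-⊑ g {π} {τ} q c {ρ} gρ≡y (r , ¬r) with ⊑-compare (c gρ≡y (⊑-trans r q , ¬τ⊑ρ q)) q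
    where
    ¬τ⊑ρ : ∀ {τ} → fin π ⊑ τ → ¬ (τ ⊑ fin ρ)
    ¬τ⊑ρ {fin _} q t = ¬r (⊑-trans q t)
    ¬τ⊑ρ {inf _} q ()
  ... | inj₁ t         = t
  ... | inj₂ (fin-≋ e) = fin-≋ (≋-sym e)
  ... | inj₂ (fin-▹ t) = ⊥-elim (¬r t)

  -- Coherent plays that extend π agree on the move after π.
  follow : ∀ (g : Strategy P x) {π y y∈ τ} → next π ≡ player P →
           Coherent g (fin (π ▹ y ⟨ y∈ ⟩)) → Coherent g τ → fin π ⊏ τ →
           fin (π ▹ y ⟨ y∈ ⟩) ⊑ τ
  follow g {y∈ = y∈} π-next c c′ π⊏τ with just-of (defined g π-next y∈)
  ... | z , gπ≡z with c gπ≡z ⊏-▹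
  ...   | fin-≋ e = ⊑-trans (fin-≋ (≋-sym e)) (c′ gπ≡z π⊏τ)
  ...   | fin-▹ q = ⊥-elim (▹-⋢ ≋-refl q)

  respond-≈ : ∀ (g : Strategy P x) {π ρ π-next ρ-next y} → π ≋ ρ →
              respond g π π-next ≡ just y → ∃[ z ] respond g ρ ρ-next ≡ just z × y ≈ z
  respond-≈ g {ρ = ρ} {π-next} {ρ-next} e gπ≡y =
    just-inv (subst (λ m → Pointwise _≈_ m (respond g ρ ρ-next)) gπ≡y (respects g π-next ρ-next e))

  extend : ∀ (g : Strategy P x) {π y y∈} →
           (∀ {z} π-next → respond g π π-next ≡ just z → z ≈ y) →
           Coherent g (fin π) → Coherent g (fin (π ▹ y ⟨ y∈ ⟩))
  extend g agree c gρ≡z (fin-≋ e , ¬r)         = ⊥-elim (¬r (fin-≋ (≋-sym e)))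
  extend g agree c gρ≡z (fin-▹ (fin-▹ q) , ¬r) = fin-▹ (c gρ≡z (fin-▹ q , ▹-⋢-⊑ q))
    where
    ▹-⋢-⊑ : ∀ {π ρ y y∈} → fin ρ ⊑ fin π → ¬ (fin (π ▹ y ⟨ y∈ ⟩) ⊑ fin ρ)
    ▹-⋢-⊑ q t = <-irrefl refl (⊑-length (⊑-trans t q))
  extend g {π} agree c {ρ} {ρ-next} gρ≡z (fin-▹ (fin-≋ e) , ¬r) =
    let (w , gπ≡w , z≈w) = respond-≈ g {ρ-next = trans (sym (≋-next e)) ρ-next} e gρ≡z
    in fin-≋ (e ▹ ≈-trans z≈w (agree _ gπ≡w))

  agree-own : ∀ (g : Strategy P x) {π π-next y} → respond g π π-next ≡ just y →
              ∀ {z} π-next′ → respond g π π-next′ ≡ just z → z ≈ y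
  agree-own g gπ≡y _ gπ≡z with respond-≈ g ≋-refl gπ≡z
  ... | _ , gπ≡w , z≈w with trans (sym gπ≡w) gπ≡y
  ...   | refl = z≈w

module _ {P : Role} {x : Hypergame} (f : Strategy P x) (f′ : Strategy (adversary P) x) where

  private
    Both : Pred (Play (starter P) x) 1ℓ
    Both π = Coherent f π × Coherent f′ π

    Both-⊑ : ∀ {π τ} → fin π ⊑ τ → Both τ → Both (fin π)
    Both-⊑ q (c , c′) = Coherent-⊑ f q c , Coherent-⊑ f′ q c′

    coherent-⊑-maximal : ExcludedMiddle 1ℓ → ∀ π {ρ} → Both (fin π) → ρ ∈ f ∗ f′ → fin π ⊑ ρ
    coherent-⊑-maximal em [] _ _ = []⊑
    coherent-⊑-maximal em (π ▹ y ⟨ y∈ ⟩) {ρ} b@(c , c′) ρ-max@((d , d′) , max)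
      with coherent-⊑-maximal em π (Both-⊑ (fin-▹ (fin-≋ ≋-refl)) b) ρ-max | em {ρ ⊑ fin π}
    ... | q | yes r = max _ b (⊑-▹ r)
      where
      ⊑-▹ : ∀ {ρ} → ρ ⊑ fin π → ρ ⊑ fin (π ▹ y ⟨ y∈ ⟩)
      ⊑-▹ {fin _} r = fin-▹ r
    ... | q | no ¬r with turn P (next π)
    ...   | mine π-next   = follow f π-next c d (q , ¬r)
    ...   | theirs π-next = follow f′ π-next c′ d′ (q , ¬r)

  ∗-unique : ExcludedMiddle 1ℓ → ∀ {π ρ} → π ∈ f ∗ f′ → ρ ∈ f ∗ f′ → π ⊑ ρ
  ∗-unique em {fin π} {ρ}     (b , _)         ρ-max = coherent-⊑-maximal em π b ρ-max
  ∗-unique em {inf α} {fin ρ} (b , max)       (b′ , max′) = max′ _ b (coherent-⊑-maximal em ρ b′ (b , max))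
  ∗-unique em {inf α} {inf β} (b , _)         ρ-max = inf-inf agree
    where
    agree : ∀ i → position α i ≈ position β i
    agree i with take α i
    ... | π , refl , q =
      ≈-trans (≈-sym (⊑-last q)) (⊑-last (coherent-⊑-maximal em π (Both-⊑ q b) ρ-max))

  private
    reply : ExcludedMiddle 1ℓ → ∀ π → Both (fin π) → ¬ Empty (Options (next π) (last π)) →
            ∃[ y ] ∃[ y∈ ] Both (fin (π ▹ y ⟨ y∈ ⟩))
    reply em π (c , c′) nonempty with em {∃[ y ] y ∈ Options (next π) (last π)}
    ... | no ¬y = ⊥-elim (nonempty λ y y∈ → ¬y (y , y∈))
    ... | yes (_ , y∈) with turn P (next π)
    ...   | mine π-next = let (z , fπ≡z) = just-of (defined f π-next y∈) in
            z , legal f fπ≡z , extend f (agree-own f fπ≡z) c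
          , extend f′ (λ π-next′ → ⊥-elim (≢opponent (trans (sym π-next) π-next′))) c′
    ...   | theirs π-next = let (z , fπ≡z) = just-of (defined f′ π-next y∈) in
            z , legal f′ fπ≡z
          , extend f (λ π-next′ → ⊥-elim (≢opponent (trans (sym π-next′) π-next))) c
          , extend f′ (agree-own f′ fπ≡z) c′

    stuck-maximal : ∀ {π} → Both (fin π) → Empty (Options (next π) (last π)) → fin π ∈ f ∗ f′
    stuck-maximal b stuck = b , λ _ _ → ⊑-stuck stuck

    module Run (em : ExcludedMiddle 1ℓ)
               (nonempty : ∀ π → Both (fin π) → ¬ Empty (Options (next π) (last π))) where

      run : ℕ → Σ (FPlay (starter P) x) λ π → Both (fin π)
      run zero    = [] , (λ { _ (fin-≋ [] , ¬r) → ⊥-elim (¬r (fin-≋ [])) })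
                       , (λ { _ (fin-≋ [] , ¬r) → ⊥-elim (¬r (fin-≋ [])) })
      run (suc n) = let (π , b) = run n ; (y , y∈ , b′) = reply em π b (nonempty π b)
                    in π ▹ y ⟨ y∈ ⟩ , b′

      run-length : ∀ n → length (proj₁ (run n)) ≡ n
      run-length zero    = refl
      run-length (suc n) = cong suc (run-length n)

      limit : IPlay (starter P) x
      limit .position n = last (proj₁ (run n))
      limit .start      = ≈-refl
      limit .move n     =
        let (π , b) = run n ; (y , y∈ , _) = reply em π b (nonempty π b)
        in Options-resp (trans (next≡mover π) (cong (mover (starter P)) (run-length n))) ≈-refl ≈-refl y∈

      run-⊑ : ∀ n → fin (proj₁ (run n)) ⊑ inf limit
      run-⊑ zero    = inf-[]
      run-⊑ (suc n) = inf-▹ (run-⊑ n)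
        (subst (λ m → position limit (suc n) ≈ position limit (suc m)) (sym (run-length n)) ≈-refl)

      ⊑-run : ∀ ρ → fin ρ ⊑ inf limit → fin ρ ⊑ fin (proj₁ (run (length ρ)))
      ⊑-run [] inf-[] = fin-≋ []
      ⊑-run (ρ ▹ y ⟨ _ ⟩) (inf-▹ q y≈) = fin-≋ (ρ≋ ▹ y≈)
        where
        ρ≋ : ρ ≋ proj₁ (run (length ρ))
        ρ≋ = ⊑-≋ (≤-reflexive (run-length (length ρ))) (⊑-run ρ q)
          where
          ⊑-≋ : ∀ {π ρ : FPlay (starter P) x} → length ρ ≤ length π → fin π ⊑ fin ρ → π ≋ ρ
          ⊑-≋ _ (fin-≋ e) = e
          ⊑-≋ l (fin-▹ q) = ⊥-elim (<-irrefl refl (≤-trans l (⊑-length q)))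

      ⊏-run : ∀ {ρ} → fin ρ ⊑ inf limit → fin ρ ⊏ fin (proj₁ (run (suc (length ρ))))
      ⊏-run {ρ} q = fin-▹ (⊑-run ρ q) , λ t →
        <-irrefl refl (subst (_≤ length ρ) (run-length (suc (length ρ))) (⊑-length t))

      limit-∈ : inf limit ∈ f ∗ f′
      limit-∈ =
          ( (λ { {ρ} fρ≡y (q , _) → ⊑-trans (proj₁ (proj₂ (run (suc (length ρ)))) fρ≡y (⊏-run q)) (run-⊑ (suc (length ρ))) })
          , (λ { {ρ} fρ≡y (q , _) → ⊑-trans (proj₂ (proj₂ (run (suc (length ρ)))) fρ≡y (⊏-run q)) (run-⊑ (suc (length ρ))) }))
        , λ { (inf β) _ (inf-inf e) → inf-inf λ i → ≈-sym (e i) }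

  ∗-exists : ExcludedMiddle 1ℓ → ∃[ π ] π ∈ f ∗ f′
  ∗-exists em with em {∃[ π ] Both (fin π) × Empty (Options (next π) (last π))}
  ... | yes (π , b , stuck) = fin π , stuck-maximal b stuck
  ... | no  ¬stuck          = inf limit , limit-∈
    where open Run em (λ π b stuck → ¬stuck (π , b , stuck))

{-# OPTIONS --safe #-}
module Submission where

-- Compare x with 0, which has no options.  The two relations then unfold to
--
--   x ⊵ 0  iff  0 ▶ xᴿ for all xᴿ        0 ▶ x  iff  xᴸ ⊵ 0 for some xᴸ
--   0 ⊵ x  iff  xᴸ ▶ 0 for all xᴸ        x ▶ 0  iff  0 ⊵ xᴿ for some xᴿ
--
-- and this is the recursion that defines "Left does not lose x when Right
-- starts" (x ⊵ 0) and "when Left starts" (0 ▶ x), and the same for Right.  The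
-- greatest fixpoint is the right one because infinite plays are draws, so not
-- losing only means that one is never stuck.  Safe p t x is the one of these
-- four relations in which p is to survive and t is to move, and each item of
-- the theorem is a conjunction of two instances of the equivalence
--
--   Safe p s x  iff  p has a non-losing strategy in the plays started by s.
--
-- From left to right (safe⇒strategy), p always moves to an option that is safe
-- with the adversary to move.  Safety is then kept along every coherent play,
-- so p has a move whenever it is p's turn, and a maximal finite play can only
-- stop at the adversary.
--
-- From right to left (strategy⇒safe), the positions at the ends of plays
-- coherent with a non-losing strategy f satisfy the recursion, hence are safe
-- by coinduction.  The adversary's moves keep coherence.  If it is p's turn
-- after a coherent play π, then p is not stuck: otherwise π would be the play
-- of f against an adversary who follows π, and f would lose it.
--
-- Strategies are functions up to bisimilarity, so building one takes the axiom
-- of choice.  It is needed only for a positional strategy, where it is applied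
-- to the small setoid of nodes of a picture of x; the strategy following π
-- departs from such a strategy only at prefixes of π, where π fixes the move.

open import Axiom.ExcludedMiddle using (ExcludedMiddle)
open import Data.Empty using (⊥-elim)
open import Data.Maybe using (Maybe; just; nothing; Is-just)
open import Data.Maybe.Relation.Binary.Pointwise using (Pointwise; just; nothing)
open import Data.Maybe.Relation.Unary.Any using (just)
open import Data.Product using (Σ; ∃-syntax; _×_; _,_; proj₁; proj₂)
open import Data.Sum using (inj₁; inj₂)
open import Data.Unit.Polymorphic using (⊤)
open import Function.Bundles using (_⇔_; mk⇔; Func; Equivalence)
open import Level using (0ℓ)
open import Relation.Binary using (Setoid)
open import Relation.Binary.PropositionalEquality using (_≡_; refl; sym; trans; cong; subst)
open import Relation.Nullary using (¬_; Dec; yes; no)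
open import Relation.Unary using (Pred; _∈_; Empty)
open import Defs

open Hypergame
open Role
open Strategy

-- Safe positions

-- p is the player who must not lose and t the one to move.  The sides of 𝟘
-- change with t because, but for draws, ▶ plays the part of the negation of ⊵.
Safe : Player → Player → Pred Hypergame 1ℓ
Safe left  left  x = 𝟘 ▶ x
Safe left  right x = x ⊵ 𝟘
Safe right left  x = 𝟘 ⊵ x
Safe right right x = x ▶ 𝟘

-- The recursion for the survival of p, where S t holds the positions at which
-- t is to move.  Safe p is its greatest solution.
record Sustains (p : Player) (S : Player → Pred Hypergame 1ℓ) : Set₁ where
  field
    answer : ∀ {x} → x ∈ S p → ∃[ y ] y ∈ Options p x × y ∈ S (opponent p)
    endure : ∀ {x y} → x ∈ S (opponent p) → y ∈ Options (opponent p) x → y ∈ S p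

open Sustains

𝟘-stuck : ∀ {p} → Empty (Options p 𝟘)
𝟘-stuck _ (option-at _ () _)

Safe-sustains : ∀ p → Sustains p (Safe p)
Safe-sustains left .answer s with proj₂ ⊵▶-postfixpoint s
... | inj₁ (_ , z∈ , _) = ⊥-elim (𝟘-stuck _ z∈)
... | inj₂ option       = option
Safe-sustains left .endure s = proj₁ (proj₁ ⊵▶-postfixpoint s) _
Safe-sustains right .answer s with proj₂ ⊵▶-postfixpoint s
... | inj₁ option       = option
... | inj₂ (_ , z∈ , _) = ⊥-elim (𝟘-stuck _ z∈)
Safe-sustains right .endure s = proj₂ (proj₁ ⊵▶-postfixpoint s) _

module _ (em : ExcludedMiddle 1ℓ) where

  -- S, put on one side of a pair whose other side is 𝟘, is a post-fixpoint
  -- of Φ; the conditions on the options of 𝟘 are void.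
  Safe-greatest : ∀ p {S} → Sustains p S → ∀ t {x} → x ∈ S t → x ∈ Safe p t
  Safe-greatest left {S} sus = λ where
      left  s → proj₂ greatest (refl , s)
      right s → proj₁ greatest (refl , s)
    where
    greatest = ⊵▶-greatest em {λ x y → y ≡ 𝟘 × x ∈ S right} {λ x y → x ≡ 𝟘 × y ∈ S left}
      ( (λ { (refl , s) → (λ _ z∈ → refl , endure sus s z∈) , λ _ z∈ → ⊥-elim (𝟘-stuck _ z∈) })
      , (λ { (refl , s) → let (z , z∈ , s′) = answer sus s in inj₂ (z , z∈ , refl , s′) }))
  Safe-greatest right {S} sus = λ where
      left  s → proj₁ greatest (refl , s)
      right s → proj₂ greatest (refl , s)
    where
    greatest = ⊵▶-greatest em {λ x y → x ≡ 𝟘 × y ∈ S left} {λ x y → y ≡ 𝟘 × x ∈ S right}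
      ( (λ { (refl , s) → (λ _ z∈ → ⊥-elim (𝟘-stuck _ z∈)) , λ _ z∈ → refl , endure sus s z∈ })
      , (λ { (refl , s) → let (z , z∈ , s′) = answer sus s in inj₁ (z , z∈ , refl , s′) }))

  -- By coinduction: the closure of Safe p under bisimilarity sustains itself.
  Safe-resp : ∀ p t {x y} → x ≈ y → x ∈ Safe p t → y ∈ Safe p t
  Safe-resp p t x≈y s = Safe-greatest p closure t (_ , x≈y , s)
    where
    closure : Sustains p λ t y → ∃[ x ] x ≈ y × x ∈ Safe p t
    closure .answer (x , x≈y , s) =
      let (z , z∈ , s′) = answer (Safe-sustains p) s
      in z , Options-resp refl x≈y ≈-refl z∈ , z , ≈-refl , s′
    closure .endure (x , x≈y , s) z∈ =
      _ , ≈-refl , endure (Safe-sustains p) s (Options-resp refl (≈-sym x≈y) ≈-refl z∈)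

-- Extending coherent plays

opponent-involutive : ∀ p → opponent (opponent p) ≡ p
opponent-involutive left  = refl
opponent-involutive right = refl

module _ {P : Role} {x : Hypergame} (f : Strategy P x) where

  Coherent-[] : Coherent f (fin [])
  Coherent-[] _ (fin-≋ [] , ¬r) = ⊥-elim (¬r (fin-≋ []))

  extend-mine : ∀ {π y} → next π ≡ player P → y ∈ Options (next π) (last π) → Coherent f (fin π) →
                ∃[ z ] Σ (z ∈ Options (next π) (last π)) λ z∈ → Coherent f (fin (π ▹ z ⟨ z∈ ⟩))
  extend-mine π-next y∈ c = let (z , fπ≡z) = just-of (defined f π-next y∈) in
    z , legal f fπ≡z , extend f (agree-own f fπ≡z) c

  extend-theirs : ∀ {π y y∈} → ¬ (next π ≡ player P) → Coherent f (fin π) →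
                  Coherent f (fin (π ▹ y ⟨ y∈ ⟩))
  extend-theirs ¬π-next = extend f (λ π-next → ⊥-elim (¬π-next π-next))

-- Whoever is to move after π has a strategy that must answer if π can go on,
-- and the extended play is still coherent with both strategies.
∗-stuck : ∀ {P x} (f : Strategy P x) (f′ : Strategy (adversary P) x) {π} →
          fin π ∈ f ∗ f′ → Empty (Options (next π) (last π))
∗-stuck {P} f f′ {π} ((c , c′) , max) y y∈ with turn P (next π)
... | mine π-next =
  let (_ , _ , d) = extend-mine f π-next y∈ c
      d′ = extend-theirs f′ (λ π-next′ → ≢opponent (trans (sym π-next) π-next′)) c′
  in ▹-⋢ ≋-refl (max _ (d , d′) (fin-▹ (fin-≋ ≋-refl)))
... | theirs π-next′ =
  let (_ , _ , d′) = extend-mine f′ π-next′ y∈ c′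
      d = extend-theirs f (λ π-next → ≢opponent (trans (sym π-next) π-next′)) c
  in ▹-⋢ ≋-refl (max _ (d , d′) (fin-▹ (fin-≋ ≋-refl)))

-- Positional strategies

-- The nodes of the picture x form a set, while hypergames and plays form proper
-- classes, to which the axiom of choice does not apply.  So moves are chosen at
-- nodes; every play ends at a hypergame depicted by one of them.
Positions : Hypergame → Setoid 0ℓ 1ℓ
Positions x = record
  { Carrier       = Node x
  ; _≈_           = λ m n → x at m ≈ x at n
  ; isEquivalence = record { refl = ≈-refl ; sym = ≈-sym ; trans = ≈-trans }
  }

locate : ∀ {s x} (π : FPlay s x) → ∃[ n ] x at n ≈ last π
locate {x = x} [] = root x , ≈-refl
locate (π ▹ y ⟨ y∈ ⟩) =
  let (n , n≈)          = locate π
      option-at m _ m≈y = Options-resp refl (≈-sym n≈) ≈-refl y∈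
  in m , m≈y

module _ (em : ExcludedMiddle 1ℓ) (ac : AxiomOfChoice 0ℓ 1ℓ 1ℓ) where

  module _ (P : Role) (x : Hypergame) {G : Pred Hypergame 1ℓ}
           (G-resp : ∀ {y z} → y ≈ z → y ∈ G → z ∈ G) where

    private
      p = player P

      -- Vacuous if y has no options, so that it is total as choice demands.
      Best : Hypergame → Hypergame → Set₁
      Best y z = ∀ {w} → w ∈ Options p y → z ∈ Options p y × (w ∈ G → z ∈ G)

      best : ∀ n → ∃[ m ] Best (x at n) (x at m)
      best n with em {∃[ y ] y ∈ Options p (x at n) × y ∈ G} | em {∃[ y ] y ∈ Options p (x at n)}
      ... | yes (y , option-at m m∈ m≈y , g) | _ =
        m , λ _ → option-at m m∈ ≈-refl , λ _ → G-resp (≈-sym m≈y) g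
      ... | no ¬good | yes (y , option-at m m∈ m≈y) =
        m , λ w∈ → option-at m m∈ ≈-refl , λ g → ⊥-elim (¬good (_ , w∈ , g))
      ... | no _ | no ¬y = n , λ w∈ → ⊥-elim (¬y (_ , w∈))

      choice : Σ (Func (Positions x) (Positions x)) λ h → ∀ n → Best (x at n) (x at Func.to h n)
      choice = ac (Positions x) (Positions x) (λ n m → Best (x at n) (x at m))
        (λ n≈n′ b w∈ → let (z∈ , g) = b (Options-resp refl (≈-sym n≈n′) ≈-refl w∈)
                       in Options-resp refl n≈n′ ≈-refl z∈ , g)
        (λ m≈m′ b w∈ → let (z∈ , g) = b w∈
                       in Options-resp refl ≈-refl m≈m′ z∈ , λ w∈G → G-resp m≈m′ (g w∈G))
        best

      HasOption : FPlay (starter P) x → Set₁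
      HasOption π = ∃[ y ] y ∈ Options (next π) (last π)

      target : FPlay (starter P) x → Hypergame
      target π = x at Func.to (proj₁ choice) (proj₁ (locate π))

      target-best : ∀ π → next π ≡ p → Best (last π) (target π)
      target-best π π-next w∈ =
        let (n , n≈) = locate π
            (z∈ , g) = proj₂ choice n (Options-resp refl (≈-sym n≈) ≈-refl w∈)
        in Options-resp refl n≈ ≈-refl z∈ , g

      target-≈ : ∀ {π ρ} → π ≋ ρ → target π ≈ target ρ
      target-≈ {π} {ρ} e = Func.cong (proj₁ choice)
        (≈-trans (proj₂ (locate π)) (≈-trans (≋-last e) (≈-sym (proj₂ (locate ρ)))))

      go : ∀ π → Dec (HasOption π) → Maybe Hypergame
      go π (yes _) = just (target π)
      go π (no  _) = nothing

      go-respects : ∀ {π ρ} → π ≋ ρ → ∀ d d′ → Pointwise _≈_ (go π d) (go ρ d′)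
      go-respects e (yes _) (yes _) = just (target-≈ e)
      go-respects e (no _)  (no _)  = nothing
      go-respects e (yes (y , y∈)) (no ¬y) =
        ⊥-elim (¬y (y , Options-resp (≋-next e) (≋-last e) ≈-refl y∈))
      go-respects e (no ¬y) (yes (y , y∈)) =
        ⊥-elim (¬y (y , Options-resp (sym (≋-next e)) (≈-sym (≋-last e)) ≈-refl y∈))

      go-best : ∀ π → next π ≡ p → ∀ d {z} → go π d ≡ just z → Best (last π) z
      go-best π π-next (yes _) refl = target-best π π-next

      go-legal : ∀ π → next π ≡ p → ∀ d {z} → go π d ≡ just z → z ∈ Options (next π) (last π)
      go-legal π π-next d@(yes (_ , y∈)) e =
        Options-resp (sym π-next) ≈-refl ≈-refl
          (proj₁ (go-best π π-next d e (Options-resp π-next ≈-refl ≈-refl y∈)))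

      go-defined : ∀ {π y} → y ∈ Options (next π) (last π) → ∀ d → Is-just (go π d)
      go-defined y∈ (yes _) = just _
      go-defined y∈ (no ¬y) = ⊥-elim (¬y (_ , y∈))

    positional : Strategy P x
    positional .respond π _                 = go π em
    positional .respects _ _ e              = go-respects e em em
    positional .legal {π} {π-next = π-next} = go-legal π π-next em
    positional .defined _ y∈                = go-defined y∈ em

    positional-prefers : ∀ π (π-next : next π ≡ p) {z} → respond positional π π-next ≡ just z →
                         ∀ {w} → w ∈ Options p (last π) → w ∈ G → z ∈ G
    positional-prefers π π-next e w∈ = proj₂ (go-best π π-next em e w∈)

-- Safety yields a non-losing strategy

  -- Along a coherent play, safety passes through p's moves because the
  -- positional strategy prefers safe options, and through the others by endure.
  safe⇒strategy : ∀ P {x} → x ∈ Safe (player P) (starter P) → Σ (Strategy P x) IsNonLosing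
  safe⇒strategy P {x} x-safe = f , nonLosing
    where
    p = player P
    G = Safe p (opponent p)

    G-resp : ∀ {y z} → y ≈ z → y ∈ G → z ∈ G
    G-resp = Safe-resp em p (opponent p)

    f : Strategy P x
    f = positional P x G-resp

    safe : ∀ π → Coherent f (fin π) → last π ∈ Safe p (next π)
    safe [] _ = x-safe
    safe (π ▹ y ⟨ y∈ ⟩) c with safe π (Coherent-⊑ f (fin-▹ (fin-≋ ≋-refl)) c) | turn P (next π)
    ... | s | theirs π-next =
      subst (λ t → y ∈ Safe p t) (sym (trans (cong opponent π-next) (opponent-involutive p)))
        (endure (Safe-sustains p) (subst (λ t → last π ∈ Safe p t) π-next s)
                                  (Options-resp π-next ≈-refl ≈-refl y∈))
    ... | s | mine π-next with just-of (defined f π-next y∈)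
    ...   | z , fπ≡z with c {ρ-next = π-next} fπ≡z ⊏-▹
    ...     | fin-▹ q           = ⊥-elim (▹-⋢ ≋-refl q)
    ...     | fin-≋ (_ ▹ z≈y) =
      let (w , w∈ , w∈G) = answer (Safe-sustains p) (subst (λ t → last π ∈ Safe p t) π-next s)
          z∈G            = positional-prefers P x G-resp π π-next fπ≡z w∈ w∈G
      in subst (λ t → y ∈ Safe p t) (sym (cong opponent π-next)) (G-resp z≈y z∈G)

    nonLosing : IsNonLosing f
    nonLosing f′ (inf _) _ = inj₂ draw
    nonLosing f′ (fin π) π∈@((c , _) , _) with turn P (next π)
    ... | theirs π-next = inj₁ (win π-next (∗-stuck f f′ π∈))
    ... | mine π-next   =
      let (w , w∈ , _) = answer (Safe-sustains p) (subst (λ t → last π ∈ Safe p t) π-next (safe π c))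
      in ⊥-elim (∗-stuck f f′ π∈ w (Options-resp (sym π-next) ≈-refl ≈-refl w∈))

-- A non-losing strategy yields safety

  -- The move made by π is determined up to ≈ by the prefix before it, so it may
  -- override a positional strategy at the prefixes of π without breaking
  -- respect for ≋; the positional one makes the strategy defined elsewhere.
  follower : ∀ P {x} (π : FPlay (starter P) x) → Σ (Strategy P x) λ f → Coherent f (fin π)
  follower P {x} π = f , coherent
    where
    default : Strategy P x
    default = positional P x {λ _ → ⊤} _

    OnTrack : FPlay (starter P) x → Set₁
    OnTrack ρ = ∃[ y ] Σ (y ∈ Options (next ρ) (last ρ)) λ y∈ → fin (ρ ▹ y ⟨ y∈ ⟩) ⊑ fin π

    transport : ∀ {ρ σ} → ρ ≋ σ → OnTrack ρ → OnTrack σ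
    transport e (y , y∈ , q) =
      y , Options-resp (≋-next e) (≋-last e) ≈-refl y∈ , ≋-⊑ (≋-sym e ▹ ≈-refl) q

    unique : ∀ {ρ σ y z y∈ z∈} → ρ ≋ σ →
             fin (ρ ▹ y ⟨ y∈ ⟩) ⊑ fin π → fin (σ ▹ z ⟨ z∈ ⟩) ⊑ fin π → y ≈ z
    unique e q r with ⊑-compare q r
    ... | inj₁ (fin-≋ (_ ▹ y≈z)) = y≈z
    ... | inj₁ (fin-▹ t)          = ⊥-elim (▹-⋢ e t)
    ... | inj₂ (fin-≋ (_ ▹ z≈y)) = ≈-sym z≈y
    ... | inj₂ (fin-▹ t)          = ⊥-elim (▹-⋢ (≋-sym e) t)

    go : ∀ ρ → next ρ ≡ player P → Dec (OnTrack ρ) → Maybe Hypergame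
    go ρ _      (yes (y , _)) = just y
    go ρ ρ-next (no _)        = respond default ρ ρ-next

    go-respects : ∀ {ρ σ} ρ-next σ-next → ρ ≋ σ → ∀ d d′ → Pointwise _≈_ (go ρ ρ-next d) (go σ σ-next d′)
    go-respects _ _ e (yes (_ , _ , q)) (yes (_ , _ , r)) = just (unique e q r)
    go-respects _ _ e (yes on) (no ¬on) = ⊥-elim (¬on (transport e on))
    go-respects _ _ e (no ¬on) (yes on) = ⊥-elim (¬on (transport (≋-sym e) on))
    go-respects ρ-next σ-next e (no _) (no _) = respects default ρ-next σ-next e

    go-legal : ∀ {ρ} ρ-next d {y} → go ρ ρ-next d ≡ just y → y ∈ Options (next ρ) (last ρ)
    go-legal ρ-next (yes (_ , y∈ , _)) refl = y∈
    go-legal ρ-next (no _)             e    = legal default {π-next = ρ-next} e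

    go-defined : ∀ {ρ y} ρ-next → y ∈ Options (next ρ) (last ρ) → ∀ d → Is-just (go ρ ρ-next d)
    go-defined ρ-next y∈ (yes _) = just _
    go-defined ρ-next y∈ (no _)  = defined default ρ-next y∈

    f : Strategy P x
    f .respond ρ ρ-next         = go ρ ρ-next em
    f .respects ρ-next σ-next e = go-respects ρ-next σ-next e em em
    f .legal {π-next = ρ-next}  = go-legal ρ-next em
    f .defined ρ-next y∈        = go-defined ρ-next y∈ em

    -- Shorten σ, a prefix of π, until it is one move longer than ρ.
    proper⇒OnTrack : ∀ {ρ σ} → fin ρ ⊑ fin σ → ¬ (fin σ ⊑ fin ρ) → fin σ ⊑ fin π → OnTrack ρ
    proper⇒OnTrack (fin-≋ e) ¬r _ = ⊥-elim (¬r (fin-≋ (≋-sym e)))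
    proper⇒OnTrack (fin-▹ {ρ = σ} {y = y} {y∈} q) ¬r s with em {fin σ ⊑ fin _}
    ... | yes t = transport (⊑-antisym t q) (y , y∈ , s)
    ... | no ¬t = proper⇒OnTrack q ¬t (▹-⊑ s)

    coherent : Coherent f (fin π)
    coherent {ρ} {ρ-next} fρ≡y (q , ¬r) = along em fρ≡y (legal f fρ≡y)
      where
      along : ∀ d {y} → go ρ ρ-next d ≡ just y → ∀ y∈ → fin (ρ ▹ y ⟨ y∈ ⟩) ⊑ fin π
      along (yes (_ , _ , t)) refl _ = ≋-⊑ (≋-refl ▹ ≈-refl) t
      along (no ¬on) _ _ = ⊥-elim (¬on (proper⇒OnTrack q ¬r (fin-≋ ≋-refl)))

  -- A dead end after π would make π the whole play against the follower of π,
  -- and the player who is to move at a dead end loses.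
  nonLosing⇒unstuck : ∀ {P x} (f : Strategy P x) → IsNonLosing f → ∀ {π} → Coherent f (fin π) →
                      next π ≡ player P → ∃[ y ] y ∈ Options (next π) (last π)
  nonLosing⇒unstuck {P} f f-nl {π} c π-next with em {∃[ y ] y ∈ Options (next π) (last π)}
  ... | yes y = y
  ... | no ¬y with follower (adversary P) π
  ...   | f′ , c′ with f-nl f′ (fin π) ((c , c′) , λ _ _ → ⊑-stuck λ y y∈ → ¬y (y , y∈))
  ...     | inj₁ (win π-next′ _) = ⊥-elim (≢opponent (trans (sym π-next) π-next′))

  strategy⇒safe : ∀ P {x} → Σ (Strategy P x) IsNonLosing → x ∈ Safe (player P) (starter P)
  strategy⇒safe P {x} (f , f-nl) =
    Safe-greatest em p reached-sustains (starter P) ([] , refl , ≈-refl , Coherent-[] f)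
    where
    p = player P

    Reached : Player → Pred Hypergame 1ℓ
    Reached t y = Σ (FPlay (starter P) x) λ π → next π ≡ t × last π ≈ y × Coherent f (fin π)

    reached-sustains : Sustains p Reached
    reached-sustains .answer (π , π-next , π≈ , c) =
      let (_ , y∈)     = nonLosing⇒unstuck f f-nl c π-next
          (z , z∈ , d) = extend-mine f π-next y∈ c
      in z , Options-resp π-next π≈ ≈-refl z∈
       , π ▹ z ⟨ z∈ ⟩ , cong opponent π-next , ≈-refl , d
    reached-sustains .endure {y = y} (π , π-next , π≈ , c) y∈ =
        π ▹ y ⟨ Options-resp (sym π-next) (≈-sym π≈) ≈-refl y∈ ⟩
      , trans (cong opponent π-next) (opponent-involutive p) , ≈-refl
      , extend-theirs f (λ π-next′ → ≢opponent (trans (sym π-next′) π-next)) c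

  side : ∀ S {x} → (x ∈ Safe (player (role₁ S)) (starter (role₁ S)) ×
                    x ∈ Safe (player (role₂ S)) (starter (role₂ S))) ⇔ HasNonLosingStrategy S x
  side S = mk⇔
    (λ (s , t) → let (f , f-nl) = safe⇒strategy (role₁ S) s
                     (g , g-nl) = safe⇒strategy (role₂ S) t
                 in (f , g) , f-nl , g-nl)
    (λ ((f , g) , f-nl , g-nl) → strategy⇒safe (role₁ S) (f , f-nl) , strategy⇒safe (role₂ S) (g , g-nl))

theorem2p22 : ExcludedMiddle 1ℓ → AxiomOfChoice 0ℓ 1ℓ 1ℓ → (x : Hypergame) →
    (x ▷ 𝟘 ⇔ HasNonLosingStrategy L x) ×
    (x ◁ 𝟘 ⇔ HasNonLosingStrategy R x) ×
    (x ⋈ 𝟘 ⇔ HasNonLosingStrategy II x) ×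
    (x ∥ 𝟘 ⇔ HasNonLosingStrategy I x)
theorem2p22 em ac x = swapped L , swapped R , side em ac II , swapped I
  where
  -- For these sides the first conjunct of the relation concerns the second role.
  swapped : ∀ S → (x ∈ Safe (player (role₂ S)) (starter (role₂ S)) ×
                   x ∈ Safe (player (role₁ S)) (starter (role₁ S))) ⇔ HasNonLosingStrategy S x
  swapped S = mk⇔ (λ (t , s) → Equivalence.to (side em ac S) (s , t))
                  (λ h → let (s , t) = Equivalence.from (side em ac S) h in t , s)
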